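{- Let $\vdash$ be an algebraizable logic with equivalent algebraic semantics the quasivariety $\mathbf{Y}$, and let $f$ be a selector term. Every $\mathsf{PAt}$-$f$-logic $\vdash_s$ (relative to $\vdash$) is complete with respect to its corresponding $\mathsf{PAt}$-$f$-quasivariety, i.e. for every pair $(\Gamma,\phi)$ with $\Gamma\cup\{\phi\}\subseteq Tm(\mathcal{L},\mathsf{Prop})$: $$\Gamma\vdash_s\phi \iff \mathsf{QVar}^f(\vdash_s)\vDash_f(\Gamma,\phi).$$
   Context: Let $\mathcal{L}$ be an algebraic language (function symbols with arities), $\mathsf{Prop}$ a fixed countably infinite set of variables, $Tm(\mathcal{L},\mathsf{Prop})$ the set of terms (also called formulas). A consequence relation on a set $C$ is a relation between subsets of $C$ and elements of $C$ that is reflexive ($W\vdash a$ if $a\in W$) and satisfies cut (if $W\vdash v$ for all $v\in V$ and $V\vdash a$ then $W\vdash a$); all consequence relations are assumed finitary (if $W\vdash a$ then $V\vdash a$ for some finite $V\subseteq W$). A logic is a consequence relation on $Tm(\mathcal{L},\mathsf{Prop})$ that is invariant under substitutions (endomorphisms of the term algebra). $\Lambda(\vdash)$ is the complete lattice of (finitary) logics extending $\vdash$. A quasivariety is a class of algebras closed under isomorphisms, subalgebras and reduced products. For a class $\mathbf{K}$, $\Theta\vDash_{\mathbf{K}}\gamma\approx\delta$ means that every assignment into an algebra of $\mathbf{K}$ satisfying all equations in $\Theta$ satisfies $\gamma\approx\delta$. The logic $\vdash$ is algebraizable with equivalent algebraic semantics the quasivariety $\mathbf{Y}$ (of language $\mathcal{L}$),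 witnessed by a finite set $\mu(x)$ of equations in one variable and a finite set $\Delta(x,y)$ of formulas in two variables: (1) $\Gamma\vdash\phi$ iff $\mu[\Gamma]\vDash_{\mathbf{Y}}\mu(\phi)$; (2) $\Theta\vDash_{\mathbf{Y}}\gamma\approx\delta$ iff $\Delta[\Theta]\vdash\Delta(\gamma,\delta)$; (3) $\phi\dashv\vdash\Delta[\mu(\phi)]$; (4) $\gamma\approx\delta$ and $\mu[\Delta(\gamma,\delta)]$ are $\vDash_{\mathbf{Y}}$-interderivable. Here $\mu[\Gamma]$ is the union of the sets $\mu(\psi)$ for $\psi\in\Gamma$, and $\Delta[\Theta]$ is the union of the sets $\Delta(\varepsilon,\upsilon)$ for $\varepsilon\approx\upsilon$ in $\Theta$. A unary term $f(x)$ of $\mathcal{L}$ is a selector term if it is idempotent, i.e. $f(f(x))\dashv\vdash f(x)$ (each of $f(f(x))$ and $f(x)$ is derivable from the other in $\vdash$). For a formula $\chi$, $\chi[f(\overline p)/\overline p]$ is the result of substituting $f(q)$ for each variable $q$ in $\chi$; $\Gamma[f(\overline p)/\overline p]$ is defined elementwise. For $\vdash_*\in\Lambda(\vdash)$ its $\mathsf{PAt}$-$f$-variant $\vdash_*^f$ is defined by $\Gamma\vdash_*^f\phi$ iff $\Gamma[f(\overline p)/\overline p]\vdash_*\phi[f(\overline p)/\overline p]$. A $\mathsf{PAt}$-$f$-logic is a relation of the form $\vdash_*^f$ with $\vdash_*\in\Lambda(\vdash)$. For $\mathcal{A}\in\mathbf{Y}$, $\mathcal{A}^f=\{a\in A: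 f(a)=a\}$ is the set of regular elements. A polyatomic model is a pair $(\mathcal{A},v)$ with $v:\mathsf{Prop}\to\mathcal{A}^f$. $\mathcal{A},v\vDash(\Gamma,\phi)$ means: if $\mathcal{A},v\vDash\mu[\Gamma]$ then $\mathcal{A},v\vDash\mu(\phi)$. $\mathcal{A}\vDash_f(\Gamma,\phi)$ means $\mathcal{A},v\vDash(\Gamma,\phi)$ for all polyatomic models $(\mathcal{A},v)$ on $\mathcal{A}$; $\mathbf{K}\vDash_f(\Gamma,\phi)$ means $\mathcal{A}\vDash_f(\Gamma,\phi)$ for all $\mathcal{A}\in\mathbf{K}$. The $\mathsf{PAt}$-$f$-quasivariety corresponding to $\vdash_s$ is $\mathsf{QVar}^f(\vdash_s)=\{\mathcal{A}\in\mathbf{Y}:\mathcal{A}\vDash_f(\Gamma,\phi)\text{ for all }(\Gamma,\phi)\in{\vdash_s}\}$.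
   Formalization: A selector term is required to satisfy f(f(a)) = f(a) in every algebra of Y, not merely f(f(x)) ⊣⊢ f(x); with mutual derivability alone the claim fails (global modal logic T, f = □, formula □p ↔ p). -}

module Defs where

open import Data.Fin.Base using (Fin)
open import Data.List.Base as List using (List)
open import Data.List.Membership.Propositional using () renaming (_∈_ to _∈ˡ_)
open import Data.Nat.Base using (ℕ)
open import Data.Product.Base using (∃; ∃-syntax; _×_; _,_; proj₁; proj₂)
open import Data.Vec.Base as Vec using (Vec; []; _∷_; lookup)
open import Data.Vec.Relation.Binary.Pointwise.Inductive
  using (Pointwise; []; _∷_)
open import Data.Vec.Relation.Unary.All using (All; []; _∷_)
open import Function.Base using (const)
open import Function.Bundles using (_⇔_; Inverse)
open import Level using (Level; _⊔_; suc)
open import Relation.Binary.Bundles using (Setoid)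
import Relation.Binary.Construct.On as On
open import Relation.Binary.PropositionalEquality using (_≡_)
open import Relation.Unary using (Pred; _∈_; _⊆_; ｛_｝; _∩_)

private
  variable
    ℓ a a′ e e′ i p x y z : Level

------------------------------------------------------------------------
-- Terms and equations

record Language ℓ : Set (suc ℓ) where
  field
    Op    : Set ℓ
    arity : Op → ℕ

open Language public

data Term (L : Language ℓ) (X : Set x) : Set (ℓ ⊔ x) where
  var : X → Term L X
  op  : (o : Op L) → Vec (Term L X) (arity L o) → Term L X

-- The variables in Prop are the natural numbers.
Fm : Language ℓ → Set ℓ
Fm L = Term L ℕ

infix 4 _≐_

record Equation (L : Language ℓ) (X : Set x) : Set (ℓ ⊔ x) where
  constructor _≐_
  field
    lhs rhs : Term L X

module _ {L : Language ℓ} {X : Set x} {Y : Set y} (σ : X → Term L Y) where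

  sub  : Term L X → Term L Y
  subs : ∀ {n} → Vec (Term L X) n → Vec (Term L Y) n

  sub (var v)   = σ v
  sub (op o ts) = op o (subs ts)

  subs []       = []
  subs (t ∷ ts) = sub t ∷ subs ts

  subEq : Equation L X → Equation L Y
  subEq (s ≐ t) = sub s ≐ sub t

infixl 25 _⟨_⟩

_⟨_⟩ : {L : Language ℓ} {X : Set x} →
       Term L (Fin 1) → Term L X → Term L X
f ⟨ t ⟩ = sub (const t) f

⟦_⟧ : {A : Set a} → List A → Pred A a
⟦ xs ⟧ z = z ∈ˡ xs

infixr 9 _″_

_″_ : {A : Set a} {B : Set a′} → (A → B) → Pred A p → Pred B (a ⊔ a′ ⊔ p)
(g ″ P) b = ∃[ z ] (z ∈ P × b ≡ g z)

------------------------------------------------------------------------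
-- Logics

-- Infinite sets of formulas are arbitrary predicates, so a consequence
-- relation is not assumed decidable.
Consequence : Set a → (ℓ : Level) → Set (a ⊔ suc ℓ)
Consequence C ℓ = Pred C ℓ → C → Set ℓ

record IsConsequence {C : Set ℓ} (_⊢_ : Consequence C ℓ) : Set (suc ℓ) where
  field
    reflexive : ∀ {W c} → c ∈ W → W ⊢ c
    cut       : ∀ {W V c} → (∀ {v} → v ∈ V → W ⊢ v) → V ⊢ c → W ⊢ c
    finitary  : ∀ {W c} → W ⊢ c → ∃[ vs ] (⟦ vs ⟧ ⊆ W × ⟦ vs ⟧ ⊢ c)

record IsLogic {L : Language ℓ} (_⊢_ : Consequence (Fm L) ℓ) : Set (suc ℓ) where
  field
    isConsequence : IsConsequence _⊢_
    structural    : ∀ {Γ φ} (σ : ℕ → Fm L) → Γ ⊢ φ → (sub σ ″ Γ) ⊢ sub σ φ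

-- _⊢*_ ∈ Λ _⊢_
Λ : {L : Language ℓ} → Consequence (Fm L) ℓ → Pred (Consequence (Fm L) ℓ) (suc ℓ)
Λ _⊢_ _⊢*_ = IsLogic _⊢*_ × (∀ {Γ φ} → Γ ⊢ φ → Γ ⊢* φ)

------------------------------------------------------------------------
-- Algebras

-- The underlying set is a setoid, so that quotients are available.
record Algebra (L : Language ℓ) a e : Set (ℓ ⊔ suc (a ⊔ e)) where
  field
    setoid : Setoid a e
  open Setoid setoid public
    renaming (refl to ≈-refl; sym to ≈-sym; trans to ≈-trans)
  field
    -- Underlying sets are nonempty; homomorphisms ignore this element.
    inhabited   : Carrier
    interp      : (o : Op L) → Vec Carrier (arity L o) → Carrier
    interp-cong : ∀ o {us vs} → Pointwise _≈_ us vs → interp o us ≈ interp o vs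

module _ {L : Language ℓ} (A : Algebra L a e) {X : Set x} where
  open Algebra A

  eval  : (X → Carrier) → Term L X → Carrier
  evals : ∀ {n} → (X → Carrier) → Vec (Term L X) n → Vec Carrier n

  eval v (var z)   = v z
  eval v (op o ts) = interp o (evals v ts)

  evals v []       = []
  evals v (t ∷ ts) = eval v t ∷ evals v ts

  Holds : (X → Carrier) → Equation L X → Set e
  Holds v (s ≐ t) = eval v s ≈ eval v t

record _≅_ {L : Language ℓ} (A : Algebra L a e) (B : Algebra L a′ e′) :
           Set (ℓ ⊔ a ⊔ e ⊔ a′ ⊔ e′) where
  private
    module A = Algebra A
    module B = Algebra B
  field
    inverse : Inverse A.setoid B.setoid
  open Inverse inverse public
  field
    homo : ∀ o us → to (A.interp o us) B.≈ B.interp o (Vec.map to us)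

record Subuniverse {L : Language ℓ} (A : Algebra L a e) p :
                   Set (ℓ ⊔ a ⊔ e ⊔ suc p) where
  open Algebra A
  field
    Member   : Pred Carrier p
    respects : ∀ {u v} → u ≈ v → u ∈ Member → v ∈ Member
    nonempty : ∃ Member
    closed   : ∀ o {us} → All Member us → interp o us ∈ Member

module _ {L : Language ℓ} {A : Algebra L a e} (S : Subuniverse A p) where
  open Algebra A
  open Subuniverse S

  private
    members : ∀ {n} (us : Vec (∃ Member) n) → All Member (Vec.map proj₁ us)
    members []       = []
    members (u ∷ us) = proj₂ u ∷ members us

    proj₁-cong : ∀ {n} {us vs : Vec (∃ Member) n} →
                 Pointwise (λ u v → proj₁ u ≈ proj₁ v) us vs →
                 Pointwise _≈_ (Vec.map proj₁ us) (Vec.map proj₁ vs)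
    proj₁-cong []       = []
    proj₁-cong (r ∷ rs) = r ∷ proj₁-cong rs

  Subalgebra : Algebra L (a ⊔ p) e
  Subalgebra = record
    { setoid      = On.setoid setoid (proj₁ {B = Member})
    ; inhabited   = nonempty
    ; interp      = λ o us → interp o (Vec.map proj₁ us) , closed o (members us)
    ; interp-cong = λ o rs → interp-cong o (proj₁-cong rs)
    }

-- The improper filter is allowed: it makes a trivial algebra a reduced product.
record Filter (I : Set i) ℓ p : Set (i ⊔ suc (ℓ ⊔ p)) where
  field
    Large  : Pred (Pred I ℓ) p
    total  : ∀ {P} → (∀ j → j ∈ P) → P ∈ Large
    upward : ∀ {P Q} → P ⊆ Q → P ∈ Large → Q ∈ Large
    meet   : ∀ {P Q} → P ∈ Large → Q ∈ Large → (P ∩ Q) ∈ Large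

module _ {L : Language ℓ} {I : Set i} (A : I → Algebra L a a)
         (F : Filter I a p) where
  open Filter F

  private
    module A j = Algebra (A j)

    Π : Set (i ⊔ a)
    Π = ∀ j → A.Carrier j

    Agree : Π → Π → Pred I a
    Agree g h j = A._≈_ j (g j) (h j)

    at : ∀ {n} → Vec Π n → (j : I) → Vec (A.Carrier j) n
    at gs j = Vec.map (λ g → g j) gs

    agrees : ∀ {n} {gs hs : Vec Π n} →
             Pointwise (λ g h → Agree g h ∈ Large) gs hs →
             (λ j → Pointwise (A._≈_ j) (at gs j) (at hs j)) ∈ Large
    agrees []       = total λ _ → []
    agrees (r ∷ rs) = upward (λ (r′ , rs′) → r′ ∷ rs′) (meet r (agrees rs))

  ReducedProduct : Algebra L (i ⊔ a) p
  ReducedProduct = record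
    { setoid = record
      { Carrier       = Π
      ; _≈_           = λ g h → Agree g h ∈ Large
      ; isEquivalence = record
        { refl  = total λ j → A.≈-refl j
        ; sym   = upward λ {j} → A.≈-sym j
        ; trans = λ r s → upward (λ {j} (r′ , s′) → A.≈-trans j r′ s′) (meet r s)
        }
      }
    ; inhabited   = A.inhabited
    ; interp      = λ o gs j → A.interp j o (at gs j)
    ; interp-cong = λ o rs → upward (λ {j} → A.interp-cong j o) (agrees rs)
    }

------------------------------------------------------------------------
-- Quasivarieties

Class : Language ℓ → (y : Level) → Set (suc ℓ ⊔ suc y)
Class {ℓ} L y = Pred (Algebra L ℓ ℓ) y

-- Closure under isomorphic copies of subalgebras of reduced products; each of
-- the three closure conditions is a special case (one-element index type with
-- the filter P ↦ P tt, full subuniverse, identity isomorphism).  They are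
-- stated jointly because Agda has no resizing: families indexed by (a type the
-- size of) the class itself must be allowed, their reduced products live above
-- the universe of the members of Y, and only a copy B in that universe can be
-- asked to belong to Y.
record IsQuasivariety {L : Language ℓ} (Y : Class L y) : Set (suc (suc ℓ ⊔ y)) where
  field
    closed : (I : Set (suc ℓ ⊔ y)) (A : I → Algebra L ℓ ℓ) → (∀ j → A j ∈ Y) →
             (F : Filter I ℓ (suc ℓ ⊔ y)) →
             (S : Subuniverse (ReducedProduct A F) (suc ℓ ⊔ y)) →
             (B : Algebra L ℓ ℓ) → Subalgebra S ≅ B → B ∈ Y

infix 4 _⊨[_]_

_⊨[_]_ : {L : Language ℓ} →
         Pred (Equation L ℕ) z → Class L y → Equation L ℕ → Set (suc ℓ ⊔ y ⊔ z)
Θ ⊨[ Y ] ε =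
  ∀ A → A ∈ Y → ∀ (v : ℕ → Algebra.Carrier A) →
  (∀ {η} → η ∈ Θ → Holds A v η) → Holds A v ε

------------------------------------------------------------------------
-- Algebraizable logics

module _ {L : Language ℓ} (μ : List (Equation L (Fin 1))) where

  -- μ(φ) and μ[Γ]
  equationsOf : Fm L → List (Equation L ℕ)
  equationsOf φ = List.map (subEq (const φ)) μ

  equations : Pred (Fm L) z → Pred (Equation L ℕ) (ℓ ⊔ z)
  equations Γ ε = ∃[ ψ ] (ψ ∈ Γ × ε ∈ˡ equationsOf ψ)

module _ {L : Language ℓ} (Δ : List (Term L (Fin 2))) where

  -- Δ(γ,δ) and Δ[Θ]
  formulasOf : Equation L ℕ → List (Fm L)
  formulasOf (γ ≐ δ) = List.map (sub (lookup (γ ∷ δ ∷ []))) Δ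

  formulas : Pred (Equation L ℕ) z → Pred (Fm L) (ℓ ⊔ z)
  formulas Θ ψ = ∃[ ε ] (ε ∈ Θ × ψ ∈ˡ formulasOf ε)

record IsAlgebraizable {L : Language ℓ} (_⊢_ : Consequence (Fm L) ℓ)
                       (Y : Class L y) (μ : List (Equation L (Fin 1)))
                       (Δ : List (Term L (Fin 2))) : Set (suc ℓ ⊔ y) where
  field
    completeness  : ∀ {Γ φ} →
                    Γ ⊢ φ ⇔
                    (∀ {ε} → ε ∈ˡ equationsOf μ φ → equations μ Γ ⊨[ Y ] ε)
    completeness′ : ∀ {Θ : Pred (Equation L ℕ) ℓ} {ε} →
                    Θ ⊨[ Y ] ε ⇔
                    (∀ {ψ} → ψ ∈ˡ formulasOf Δ ε → formulas Δ Θ ⊢ ψ)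
    φ⊢Δμφ         : ∀ {φ ψ} → ψ ∈ formulas Δ ⟦ equationsOf μ φ ⟧ → ｛ φ ｝ ⊢ ψ
    Δμφ⊢φ         : ∀ {φ} → formulas Δ ⟦ equationsOf μ φ ⟧ ⊢ φ
    ε⊨μΔε         : ∀ {ε η} → η ∈ equations μ ⟦ formulasOf Δ ε ⟧ → ｛ ε ｝ ⊨[ Y ] η
    μΔε⊨ε         : ∀ {ε} → equations μ ⟦ formulasOf Δ ε ⟧ ⊨[ Y ] ε

------------------------------------------------------------------------
-- Polyatomic logics

-- Idempotence is required of f as an operation on the algebras of Y.  In an
-- algebraizable logic this implies that f(f(x)) and f(x) are interderivable,
-- but not conversely: in the global consequence of the modal logic T,
-- □□x ⊣⊢ □x although □□x ≈ □x fails in some T-algebra.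
record IsSelector {L : Language ℓ} (_⊢_ : Consequence (Fm L) ℓ) (Y : Class L y)
                  (f : Term L (Fin 1)) : Set (suc ℓ ⊔ y) where
  field
    ffx⊢fx     : ｛ f ⟨ f ⟨ var 0 ⟩ ⟩ ｝ ⊢ f ⟨ var 0 ⟩
    fx⊢ffx     : ｛ f ⟨ var 0 ⟩ ｝ ⊢ f ⟨ f ⟨ var 0 ⟩ ⟩
    idempotent : ∀ A → A ∈ Y → ∀ (v : Fin 1 → Algebra.Carrier A) →
                 Holds A v (f ⟨ f ⟩ ≐ f)

module _ {L : Language ℓ} (f : Term L (Fin 1)) where

  -- χ ↦ χ[f(p̄)/p̄]
  atomwise : Fm L → Fm L
  atomwise = sub (λ n → f ⟨ var n ⟩)

  Variant : Consequence (Fm L) ℓ → Consequence (Fm L) ℓ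
  Variant _⊢*_ Γ φ = (atomwise ″ Γ) ⊢* atomwise φ

  IsPAtLogic : Consequence (Fm L) ℓ → Pred (Consequence (Fm L) ℓ) (suc ℓ)
  IsPAtLogic _⊢_ _⊢ₛ_ =
    ∃[ _⊢*_ ] (_⊢*_ ∈ Λ _⊢_ × (∀ {Γ φ} → (Γ ⊢ₛ φ) ⇔ Variant _⊢*_ Γ φ))

  Regular : (A : Algebra L a e) → Pred (Algebra.Carrier A) e
  Regular A u = eval A (const u) f ≈ u
    where open Algebra A

-- A ⊨ᶠ (Γ , φ), relative to μ
Validᶠ : {L : Language ℓ} → List (Equation L (Fin 1)) → Term L (Fin 1) →
         Algebra L a e → Pred (Fm L) z × Fm L → Set (ℓ ⊔ a ⊔ e ⊔ z)
Validᶠ μ f A (Γ , φ) =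
  (v : ℕ → Algebra.Carrier A) → (∀ n → v n ∈ Regular f A) →
  (∀ {ε} → ε ∈ equations μ Γ → Holds A v ε) →
  ∀ {ε} → ε ∈ˡ equationsOf μ φ → Holds A v ε

infix 4 _⊨ᶠ⟨_,_⟩_

_⊨ᶠ⟨_,_⟩_ : {L : Language ℓ} → Class L y → List (Equation L (Fin 1)) →
            Term L (Fin 1) → Pred (Fm L) z × Fm L → Set (suc ℓ ⊔ y ⊔ z)
K ⊨ᶠ⟨ μ , f ⟩ Γφ = ∀ A → A ∈ K → Validᶠ μ f A Γφ

QVarᶠ : {L : Language ℓ} → List (Equation L (Fin 1)) → Term L (Fin 1) →
        Class L y → Consequence (Fm L) ℓ → Class L (suc ℓ ⊔ y)
QVarᶠ μ f Y _⊢ₛ_ A = A ∈ Y × (∀ {Γ φ} → Γ ⊢ₛ φ → Validᶠ μ f A (Γ , φ))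

{-# OPTIONS --safe #-}
module Submission where

-- Soundness is immediate from the definition of the corresponding
-- quasivariety.  For completeness, let Γ and φ be given, let _⊢*_ be a logic
-- whose variant is _⊢ₛ_, and let T be the set of _⊢*_-consequences of
-- Γ[f(p̄)/p̄].  Identifying γ with δ whenever Δ(γ,δ) ⊆ T turns the term algebra
-- into the Lindenbaum algebra of T.  It has three properties:
--
--  * It belongs to Y.  The identified pairs are closed under ⊨[ Y ]
--    (≑-closed), so they are exactly the equations true in every pair (A , v)
--    with A ∈ Y that satisfies all of them; hence the Lindenbaum algebra
--    embeds into the product of all these A (lindenbaum∈Y).
--
--  * Under an assignment v, which is the same thing as a substitution, it
--    satisfies μ(ψ) iff sub v ψ ∈ T (∈T⇒holds, holds⇒∈T).
--
--  * It validates _⊢ₛ_ on regular assignments (lindenbaum∈QVar): if v is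
--    regular, then v and p ↦ f(v(p)) agree up to the congruence, so that
--    replacing p by f(p) does not change the truth of μ(ψ), and the claim
--    reduces to closure of T under substitution instances of _⊢*_.
--
-- As f is idempotent on Y, the assignment p ↦ f(p) is regular.  It satisfies
-- μ[Γ], because Γ[f(p̄)/p̄] ⊆ T.  If (Γ , φ) is valid it therefore satisfies
-- μ(φ), that is, φ[f(p̄)/p̄] ∈ T, which is Γ ⊢ₛ φ.

open import Data.Fin.Base using (Fin)
open import Data.List.Base using (List)
open import Data.List.Membership.Propositional.Properties using (∈-map⁺; ∈-map⁻)
open import Data.Nat.Base using (ℕ)
open import Data.Product.Base using (_×_; _,_; proj₁; proj₂; ∃-syntax)
open import Data.Vec.Base as Vec using (Vec; []; _∷_)
open import Data.Vec.Relation.Binary.Pointwise.Inductive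
  using (Pointwise; []; _∷_)
open import Data.Vec.Relation.Unary.All using (All; []; _∷_)
open import Function.Base using (const)
open import Function.Bundles using (_⇔_; mk⇔; Equivalence)
open import Level using (Level; _⊔_) renaming (suc to lsuc)
open import Relation.Binary.PropositionalEquality
  using (_≡_; refl; sym; trans; cong; cong₂; subst)
open import Relation.Unary using (Pred; _∈_; _⊆_)
open import Defs

private
  variable
    ℓ a e x z : Level

-- Evaluation and substitution

module _ {L : Language ℓ} where

  sub-sub : {X : Set x} {Z W : Set z} (σ : Z → Term L W) (τ : X → Term L Z) →
            ∀ t → sub σ (sub τ t) ≡ sub (λ n → sub σ (τ n)) t
  subs-sub : {X : Set x} {Z W : Set z} (σ : Z → Term L W) (τ : X → Term L Z) →
             ∀ {n} (ts : Vec (Term L X) n) →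
             subs σ (subs τ ts) ≡ subs (λ n → sub σ (τ n)) ts
  sub-sub σ τ (var n)   = refl
  sub-sub σ τ (op o ts) = cong (op o) (subs-sub σ τ ts)
  subs-sub σ τ []       = refl
  subs-sub σ τ (t ∷ ts) = cong₂ _∷_ (sub-sub σ τ t) (subs-sub σ τ ts)

module _ {L : Language ℓ} (A : Algebra L a e) where
  open Algebra A

  eval-cong : {X : Set x} {v w : X → Carrier} → (∀ n → v n ≈ w n) →
              ∀ t → eval A v t ≈ eval A w t
  evals-cong : {X : Set x} {v w : X → Carrier} → (∀ n → v n ≈ w n) →
               ∀ {n} (ts : Vec (Term L X) n) →
               Pointwise _≈_ (evals A v ts) (evals A w ts)
  eval-cong r (var n)   = r n
  eval-cong r (op o ts) = interp-cong o (evals-cong r ts)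
  evals-cong r []       = []
  evals-cong r (t ∷ ts) = eval-cong r t ∷ evals-cong r ts

  Holds-cong : {X : Set x} {v w : X → Carrier} → (∀ n → v n ≈ w n) →
               ∀ ε → Holds A v ε → Holds A w ε
  Holds-cong r (s ≐ t) h =
    ≈-trans (≈-sym (eval-cong r s)) (≈-trans h (eval-cong r t))

-- The Lindenbaum algebra of a theory

-- T is a theory of _⊢_: a set of formulas closed under consequence.
module Lindenbaum
  {ℓ y : Level} {L : Language ℓ} {_⊢_ : Consequence (Fm L) ℓ}
  {Y : Class L y} (quasivariety : IsQuasivariety Y)
  {μ : List (Equation L (Fin 1))} {Δ : List (Term L (Fin 2))}
  (algebraizable : IsAlgebraizable _⊢_ Y μ Δ)
  (T : Pred (Fm L) ℓ)
  (theory : ∀ {W ψ} → W ⊆ T → W ⊢ ψ → ψ ∈ T)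
  where

  open IsAlgebraizable algebraizable

  -- The equations γ ≐ δ with Δ(γ,δ) ⊆ T.
  Θ : Pred (Equation L ℕ) ℓ
  Θ ε = ⟦ formulasOf Δ ε ⟧ ⊆ T

  infix 4 _≑_

  -- Θ as a relation, wrapped in a record so that γ and δ can be inferred.
  record _≑_ (γ δ : Fm L) : Set ℓ where
    constructor equal
    field
      inT : Θ (γ ≐ δ)
  open _≑_

  ≑-closed : ∀ {γ δ} → Θ ⊨[ Y ] (γ ≐ δ) → γ ≑ δ
  ≑-closed h = equal λ m →
    theory (λ (_ , θ , k) → θ k) (Equivalence.to completeness′ h m)

  private
    evals-≑ : ∀ (A : Algebra L ℓ ℓ) (v : ℕ → Algebra.Carrier A) →
              (∀ {ε} → ε ∈ Θ → Holds A v ε) →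
              ∀ {n} {ss ts : Vec (Fm L) n} → Pointwise _≑_ ss ts →
              Pointwise (Algebra._≈_ A) (evals A v ss) (evals A v ts)
    evals-≑ A v h []             = []
    evals-≑ A v h (equal r ∷ rs) = h r ∷ evals-≑ A v h rs

  -- The term algebra modulo _≑_.  The congruence laws are consequences under
  -- ⊨[ Y ] and thus follow from ≑-closed.
  lindenbaum : Algebra L ℓ ℓ
  lindenbaum = record
    { setoid = record
      { Carrier       = Fm L
      ; _≈_           = _≑_
      ; isEquivalence = record
        { refl  = ≑-closed λ A _ _ _ → Algebra.≈-refl A
        ; sym   = λ r → ≑-closed λ A _ _ h → Algebra.≈-sym A (h (inT r))
        ; trans = λ r s → ≑-closed λ A _ _ h →
                    Algebra.≈-trans A (h (inT r)) (h (inT s))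
        }
      }
    ; inhabited   = var 0
    ; interp      = op
    ; interp-cong = λ o rs → ≑-closed λ A _ v h →
                      Algebra.interp-cong A o (evals-≑ A v h rs)
    }

  module B = Algebra lindenbaum

  eval≡sub : {X : Set x} (σ : X → Fm L) (t : Term L X) →
             eval lindenbaum σ t ≡ sub σ t
  evals≡subs : {X : Set x} (σ : X → Fm L) → ∀ {n} (ts : Vec (Term L X) n) →
               evals lindenbaum σ ts ≡ subs σ ts
  eval≡sub σ (var n)   = refl
  eval≡sub σ (op o ts) = cong (op o) (evals≡subs σ ts)
  evals≡subs σ []       = refl
  evals≡subs σ (t ∷ ts) = cong₂ _∷_ (eval≡sub σ t) (evals≡subs σ ts)

  -- Membership in Y

  -- The models of Θ on members of Y.
  Model : Set (lsuc ℓ ⊔ y)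
  Model = ∃[ A ] (A ∈ Y × ∃[ v ] (∀ {ε} → ε ∈ Θ → Holds {L = L} A v ε))

  private
    module Md (j : Model) = Algebra (proj₁ j)

    value : (j : Model) → Fm L → Md.Carrier j
    value (A , _ , v , _) = eval A v

    values : (j : Model) → ∀ {n} → Vec (Fm L) n → Vec (Md.Carrier j) n
    values (A , _ , v , _) = evals A v

  -- The filter containing only the full index set: the reduced product is the
  -- direct product.
  fullFilter : Filter Model ℓ (lsuc ℓ ⊔ y)
  fullFilter = record
    { Large  = λ P → ∀ j → P j
    ; total  = λ p → p
    ; upward = λ i p j → i (p j)
    ; meet   = λ p q j → p j , q j
    }

  private
    Prod : Algebra L (lsuc ℓ ⊔ y) (lsuc ℓ ⊔ y)
    Prod = ReducedProduct proj₁ fullFilter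

    -- The tuples that are the value of a single term in every model.
    Named : Pred (Algebra.Carrier Prod) (lsuc ℓ ⊔ y)
    Named g = ∃[ t ] (∀ j → Md._≈_ j (g j) (value j t))

    names : ∀ {n} {gs : Vec (Algebra.Carrier Prod) n} → All Named gs →
            Vec (Fm L) n
    names []             = []
    names ((t , _) ∷ ps) = t ∷ names ps

    names-correct : ∀ {n} {gs : Vec (Algebra.Carrier Prod) n}
                    (ps : All Named gs) j →
                    Pointwise (Md._≈_ j) (Vec.map (λ g → g j) gs)
                                         (values j (names ps))
    names-correct []             j = []
    names-correct ((_ , r) ∷ ps) j = r j ∷ names-correct ps j

    -- The image of the term algebra in the product.
    named : Subuniverse Prod (lsuc ℓ ⊔ y)
    named = record
      { Member   = Named
      ; respects = λ u≈v (t , r) → t , λ j →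
                     Md.≈-trans j (Md.≈-sym j (u≈v j)) (r j)
      ; nonempty = (λ j → value j (var 0)) , var 0 , λ j → Md.≈-refl j
      ; closed   = λ o ps → op o (names ps) , λ j →
                     Md.interp-cong j o (names-correct ps j)
      }

    module S = Algebra (Subalgebra named)

    name : S.Carrier → Fm L
    name (_ , t , _) = t

    name-correct : ∀ u j → Md._≈_ j (proj₁ u j) (value j (name u))
    name-correct (_ , _ , r) = r

    map-name-correct : ∀ {n} (us : Vec S.Carrier n) j →
                       Pointwise (Md._≈_ j)
                         (Vec.map (λ g → g j) (Vec.map proj₁ us))
                         (values j (Vec.map name us))
    map-name-correct []       j = []
    map-name-correct (u ∷ us) j = name-correct u j ∷ map-name-correct us j

    tuple : Fm L → S.Carrier
    tuple t = (λ j → value j t) , t , λ j → Md.≈-refl j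

    ≑-models : ∀ {γ δ} → (∀ j → Md._≈_ j (value j γ) (value j δ)) → γ ≑ δ
    ≑-models h = ≑-closed λ A A∈Y v k → h (A , A∈Y , v , k)

    value-cong : ∀ {γ δ} → γ ≑ δ → ∀ j → Md._≈_ j (value j γ) (value j δ)
    value-cong (equal r) (_ , _ , _ , h) = h r

    name-cong : ∀ {u w} → u S.≈ w → name u ≑ name w
    name-cong {u} {w} r = ≑-models λ j →
      Md.≈-trans j (Md.≈-sym j (name-correct u j))
        (Md.≈-trans j (r j) (name-correct w j))

    tuple-name : ∀ {t u} → t ≑ name u → tuple t S.≈ u
    tuple-name {u = u} r j =
      Md.≈-trans j (value-cong r j) (Md.≈-sym j (name-correct u j))

    named≅lindenbaum : Subalgebra named ≅ lindenbaum
    named≅lindenbaum = record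
      { inverse = record
        { to        = name
        ; from      = tuple
        ; to-cong   = λ {u} {w} → name-cong {u} {w}
        ; from-cong = value-cong
        ; inverse   = (λ {t} {u} → name-cong {u} {tuple t})
                    , (λ {u} → tuple-name {u = u})
        }
      ; homo = λ o us → ≑-models λ j →
          Md.≈-trans j (Md.≈-sym j (name-correct (S.interp o us) j))
            (Md.interp-cong j o (map-name-correct us j))
      }

  lindenbaum∈Y : lindenbaum ∈ Y
  lindenbaum∈Y = IsQuasivariety.closed quasivariety Model proj₁
    (λ (_ , A∈Y , _) → A∈Y) fullFilter named lindenbaum named≅lindenbaum

  -- Truth in the Lindenbaum algebra

  private
    -- An instance s(ψ) ≐ t(ψ) holds under v iff s(sub v ψ) and t(sub v ψ) are
    -- identified.
    holds-instance : ∀ (v : ℕ → Fm L) ψ ε →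
                     Holds lindenbaum v (subEq (const ψ) ε) ≡
                     (Equation.lhs ε ⟨ sub v ψ ⟩ ≑ Equation.rhs ε ⟨ sub v ψ ⟩)
    holds-instance v ψ (s ≐ t) = cong₂ _≑_ (side s) (side t)
      where
      side : ∀ s → eval lindenbaum v (s ⟨ ψ ⟩) ≡ s ⟨ sub v ψ ⟩
      side s = trans (eval≡sub v (s ⟨ ψ ⟩)) (sub-sub v (const ψ) s)

  ∈T⇒holds : ∀ (v : ℕ → Fm L) ψ → sub v ψ ∈ T →
             ∀ {ε} → ε ∈ ⟦ equationsOf μ ψ ⟧ → Holds lindenbaum v ε
  ∈T⇒holds v ψ vψ∈T m with ∈-map⁻ (subEq (const ψ)) m
  ... | ε , ε∈μ , refl =
    subst (λ P → P) (sym (holds-instance v ψ ε)) (equal λ k →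
      theory (λ { refl → vψ∈T })
        (φ⊢Δμφ (_ , ∈-map⁺ (subEq (const (sub v ψ))) ε∈μ , k)))

  holds⇒∈T : ∀ (v : ℕ → Fm L) ψ →
             (∀ {ε} → ε ∈ ⟦ equationsOf μ ψ ⟧ → Holds lindenbaum v ε) →
             sub v ψ ∈ T
  holds⇒∈T v ψ h = theory Δμ⊆T Δμφ⊢φ
    where
    Δμ⊆T : formulas Δ ⟦ equationsOf μ (sub v ψ) ⟧ ⊆ T
    Δμ⊆T (_ , m , k) with ∈-map⁻ (subEq (const (sub v ψ))) m
    ... | ε , ε∈μ , refl =
      inT (subst (λ P → P) (holds-instance v ψ ε)
                 (h (∈-map⁺ (subEq (const ψ)) ε∈μ))) k

  -- Regular assignments

  module _ (f : Term L (Fin 1)) where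

    regular⇒f≑ : ∀ (v : ℕ → Fm L) → (∀ n → v n ∈ Regular f lindenbaum) →
                 ∀ n → v n ≑ sub v (f ⟨ var n ⟩)
    regular⇒f≑ v reg n =
      subst (v n ≑_)
        (trans (eval≡sub (const (v n)) f) (sym (sub-sub v (const (var n)) f)))
        (B.≈-sym (reg n))

    -- Truth of μ(ψ) at a regular assignment v, which holds⇒∈T and ∈T⇒holds
    -- relate to sub v ψ ∈ T, can also be tested on ψ[f(p̄)/p̄], because v agrees
    -- with p ↦ f(v(p)) up to the congruence.
    atomwise-∈T : ∀ (v : ℕ → Fm L) → (∀ n → v n ∈ Regular f lindenbaum) → ∀ ψ →
                  (∀ {ε} → ε ∈ ⟦ equationsOf μ ψ ⟧ → Holds lindenbaum v ε) ⇔
                  sub v (atomwise f ψ) ∈ T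
    atomwise-∈T v reg ψ = mk⇔
      (λ h → subst T (sym eq)
         (holds⇒∈T w ψ λ {ε} m → Holds-cong lindenbaum v≑w ε (h m)))
      (λ p {ε} m → Holds-cong lindenbaum (λ n → B.≈-sym (v≑w n)) ε
         (∈T⇒holds w ψ (subst T eq p) m))
      where
      w : ℕ → Fm L
      w n = sub v (f ⟨ var n ⟩)

      v≑w : ∀ n → v n ≑ w n
      v≑w = regular⇒f≑ v reg

      eq : sub v (atomwise f ψ) ≡ sub w ψ
      eq = sub-sub v (λ n → f ⟨ var n ⟩) ψ

    f-regular : IsSelector _⊢_ Y f →
                ∀ n → f ⟨ var n ⟩ ∈ Regular f lindenbaum
    f-regular selector n =
      subst (_≑ f ⟨ var n ⟩) ff
        (subst (eval lindenbaum (const (var n)) (f ⟨ f ⟩) ≑_)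
          (eval≡sub (const (var n)) f)
          (idempotent lindenbaum lindenbaum∈Y (const (var n))))
      where
      open IsSelector selector

      ff : eval lindenbaum (const (var n)) (f ⟨ f ⟩) ≡
           eval lindenbaum (const (f ⟨ var n ⟩)) f
      ff = trans (eval≡sub (const (var n)) (f ⟨ f ⟩))
             (trans (sub-sub (const (var n)) (const f) f)
                    (sym (eval≡sub (const (f ⟨ var n ⟩)) f)))

    -- T must moreover be a theory of the logic _⊢*_ that _⊢ₛ_ is a variant of.
    lindenbaum∈QVar : ∀ {_⊢ₛ_ _⊢*_} → IsLogic _⊢*_ →
                      (∀ {Γ φ} → (Γ ⊢ₛ φ) ⇔ Variant f _⊢*_ Γ φ) →
                      (∀ {W ψ} → W ⊆ T → W ⊢* ψ → ψ ∈ T) →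
                      lindenbaum ∈ QVarᶠ μ f Y _⊢ₛ_
    lindenbaum∈QVar logic variant theory* =
      lindenbaum∈Y , λ {Γ} {φ} Γ⊢ₛφ v reg h →
        Equivalence.from (atomwise-∈T v reg φ)
          (theory*
            (λ { (_ , (ψ , ψ∈Γ , refl) , refl) →
                 Equivalence.to (atomwise-∈T v reg ψ)
                   (λ m → h (ψ , ψ∈Γ , m)) })
            (IsLogic.structural logic v (Equivalence.to variant Γ⊢ₛφ)))

-- Completeness

theorem3p26 : ∀ {ℓ y : Level} (L : Language ℓ) (_⊢_ : Consequence (Fm L) ℓ) → IsLogic _⊢_ →
    (Y : Class L y) → IsQuasivariety Y →
    (μ : List (Equation L (Fin 1))) (Δ : List (Term L (Fin 2))) →
    IsAlgebraizable _⊢_ Y μ Δ →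
    (f : Term L (Fin 1)) → IsSelector _⊢_ Y f →
    (_⊢ₛ_ : Consequence (Fm L) ℓ) → IsPAtLogic f _⊢_ _⊢ₛ_ →
    (Γ : Pred (Fm L) ℓ) (φ : Fm L) →
    (Γ ⊢ₛ φ) ⇔ (QVarᶠ μ f Y _⊢ₛ_ ⊨ᶠ⟨ μ , f ⟩ (Γ , φ))
theorem3p26 L _⊢_ _ Y quasivariety μ Δ algebraizable f selector _⊢ₛ_
            (_⊢*_ , (logic , extends) , variant) Γ φ = mk⇔ sound complete
  where
  open IsConsequence (IsLogic.isConsequence logic)

  T : Pred (Fm L) _
  T ψ = (atomwise f ″ Γ) ⊢* ψ

  open Lindenbaum quasivariety algebraizable T
    (λ W⊆T W⊢ψ → cut W⊆T (extends W⊢ψ))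

  sound : Γ ⊢ₛ φ → QVarᶠ μ f Y _⊢ₛ_ ⊨ᶠ⟨ μ , f ⟩ (Γ , φ)
  sound Γ⊢ₛφ _ (_ , valid) = valid Γ⊢ₛφ

  complete : QVarᶠ μ f Y _⊢ₛ_ ⊨ᶠ⟨ μ , f ⟩ (Γ , φ) → Γ ⊢ₛ φ
  complete valid = Equivalence.from variant (holds⇒∈T v φ
    (valid lindenbaum
      (lindenbaum∈QVar f logic variant (λ W⊆T W⊢ψ → cut W⊆T W⊢ψ))
      v (f-regular f selector)
      -- sub v is atomwise f, so sub v ψ is in T for ψ in Γ
      λ (ψ , ψ∈Γ , m) → ∈T⇒holds v ψ (reflexive (ψ , ψ∈Γ , refl)) m))
    where
    v : ℕ → Fm L
    v n = f ⟨ var n ⟩
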